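{- For every positive integer $m$, $$\min\left(\frac{\lfloor\sqrt{m}\rfloor+1}{m},\ \frac{1}{\lfloor\sqrt{m}\rfloor}\right)\le L_{\min}(m),$$ where $L_{\min}(m)$ is the minimal data storage limit of an ATAC (All-to-All Comparison) data distribution on $m$ machines.
   Context: Let $m$ be a positive integer (the number of machines). A data distribution on $m$ machines is a pair $(D,\vec{s})$, where, for some positive integer $x$ (the number of data groups, not fixed in advance), $D=(d_{ij})$ is an $m\times x$ matrix with entries in $\{0,1\}$ ($d_{ij}=1$ iff data group $j$ is stored on machine $i$), and $\vec{s}\in\mathbb{R}^x$ is a column vector with non-negative entries summing to $1$ ($s_j$ is the fraction of all data lying in data group $j$). It is an ATAC (All-to-All Comparison) data distribution if every entry of $D^TD$ is nonzero, i.e. for every pair of data groups (including a group paired with itself) some machine holds both. The data storage limit of $(D,\vec{s})$ is $L(D,\vec{s})=\max_{1\le i\le m}(D\vec{s})_i$. The minimal data storage limit $L_{\min}(m)$ is the minimum of $L(D,\vec{s})$ over all ATAC data distributions $(D,\vec{s})$ on $m$ machines (over all $x$). -}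

module Defs where

open import Algebra.Bundles.Raw using (RawMonoid)
import Algebra.Definitions.RawMonoid as RawMonoidDefs
import Algebra.Properties.CommutativeSemigroup as CommutativeSemigroupProperties
import Algebra.Properties.Group as GroupProperties
open import Algebra.Bundles using (module CommutativeMonoid)
open import Data.Empty using (⊥-elim-irr)
open import Data.Fin.Base using (Fin; zero; suc; toℕ)
open import Data.Nat.Base as ℕ using (ℕ; zero; suc; NonZero)
import Data.Nat.Properties as ℕ
open import Data.Product.Base using (∃; ∃-syntax; _×_; _,_)
open import Data.Rational.Base as ℚ using (ℚ; 0ℚ; 1ℚ; ½)
import Data.Rational.Properties as ℚ
open import Data.Sum.Base using (inj₁; inj₂)
open import Data.Vec.Functional using (Vector; head; tail)
open import Function.Base using (_$_)
open import Relation.Binary.PropositionalEquality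
  using (_≡_; _≢_; refl; sym; trans; cong; subst; module ≡-Reasoning)
open import Relation.Nullary using (yes; no)

------------------------------------------------------------------------
-- Real numbers

-- The library has no real numbers.  Here they are Cauchy sequences of rationals
-- with a modulus of convergence, compared through the setoid equality _≃_.

IsCauchy : (ℕ → ℚ) → Set
IsCauchy x = ∀ ε → 0ℚ ℚ.< ε →
  ∃[ N ] ∀ i j → N ℕ.≤ i → N ℕ.≤ j → ℚ.∣ x i ℚ.- x j ∣ ℚ.≤ ε

record ℝ : Set where
  constructor mkℝ
  field
    seq    : ℕ → ℚ
    cauchy : IsCauchy seq

open ℝ public

infix 4 _≤_ _≃_

record _≤_ (x y : ℝ) : Set where
  constructor mk≤
  field
    eventually : ∀ ε → 0ℚ ℚ.< ε →
      ∃[ N ] ∀ i → N ℕ.≤ i → seq x i ℚ.≤ seq y i ℚ.+ ε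

open _≤_ public

_≃_ : ℝ → ℝ → Set
x ≃ y = x ≤ y × y ≤ x

private
  open GroupProperties ℚ.+-0-group
    using (//-rightDividesˡ; //-rightDividesʳ; ⁻¹-anti-homo-//)
  open CommutativeSemigroupProperties
    (CommutativeMonoid.commutativeSemigroup ℚ.+-0-commutativeMonoid)
    using (interchange)

  p≡q+[p-q] : ∀ p q → p ≡ q ℚ.+ (p ℚ.- q)
  p≡q+[p-q] p q = sym (trans (ℚ.+-comm q (p ℚ.- q)) (//-rightDividesˡ q p))

  q+ε-q : ∀ q ε → (q ℚ.+ ε) ℚ.- q ≡ ε
  q+ε-q q ε = trans (cong (ℚ._- q) (ℚ.+-comm q ε)) (//-rightDividesʳ q ε)

  halves : ∀ ε → ½ ℚ.* ε ℚ.+ ½ ℚ.* ε ≡ ε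
  halves ε = begin
    ½ ℚ.* ε ℚ.+ ½ ℚ.* ε ≡⟨ ℚ.*-distribʳ-+ ε ½ ½ ⟨
    1ℚ ℚ.* ε            ≡⟨ ℚ.*-identityˡ ε ⟩
    ε                   ∎
    where open ≡-Reasoning

  half-pos : ∀ ε → 0ℚ ℚ.< ε → 0ℚ ℚ.< ½ ℚ.* ε
  half-pos ε 0<ε = subst (ℚ._< ½ ℚ.* ε) (ℚ.*-zeroʳ ½) (ℚ.*-monoʳ-<-pos ½ 0<ε)

  x≤∣x∣ : ∀ p → p ℚ.≤ ℚ.∣ p ∣
  x≤∣x∣ p with ℚ.≤-total 0ℚ p
  ... | inj₁ 0≤p = ℚ.≤-reflexive (sym (ℚ.0≤p⇒∣p∣≡p 0≤p))
  ... | inj₂ p≤0 = ℚ.≤-trans p≤0 (ℚ.0≤∣p∣ p)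

∣p-q∣≤ε⇒p≤q+ε : ∀ p q {ε} → ℚ.∣ p ℚ.- q ∣ ℚ.≤ ε → p ℚ.≤ q ℚ.+ ε
∣p-q∣≤ε⇒p≤q+ε p q {ε} h = begin
  p                 ≡⟨ p≡q+[p-q] p q ⟩
  q ℚ.+ (p ℚ.- q)   ≤⟨ ℚ.+-monoʳ-≤ q (ℚ.≤-trans (x≤∣x∣ _) h) ⟩
  q ℚ.+ ε           ∎
  where open ℚ.≤-Reasoning

p≤q+ε∧q≤p+ε⇒∣p-q∣≤ε : ∀ p q {ε} → p ℚ.≤ q ℚ.+ ε → q ℚ.≤ p ℚ.+ ε →
                      ℚ.∣ p ℚ.- q ∣ ℚ.≤ ε
p≤q+ε∧q≤p+ε⇒∣p-q∣≤ε p q {ε} h k with ℚ.∣p∣≡p∨∣p∣≡-p (p ℚ.- q)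
... | inj₁ eq = begin
  ℚ.∣ p ℚ.- q ∣     ≡⟨ eq ⟩
  p ℚ.- q           ≤⟨ ℚ.+-monoˡ-≤ (ℚ.- q) h ⟩
  (q ℚ.+ ε) ℚ.- q   ≡⟨ q+ε-q q ε ⟩
  ε                 ∎
  where open ℚ.≤-Reasoning
... | inj₂ eq = begin
  ℚ.∣ p ℚ.- q ∣     ≡⟨ eq ⟩
  ℚ.- (p ℚ.- q)     ≡⟨ ⁻¹-anti-homo-// p q ⟩
  q ℚ.- p           ≤⟨ ℚ.+-monoˡ-≤ (ℚ.- p) k ⟩
  (p ℚ.+ ε) ℚ.- p   ≡⟨ q+ε-q p ε ⟩
  ε                 ∎
  where open ℚ.≤-Reasoning

private
  +-combine : ∀ a b ε → (a ℚ.+ ½ ℚ.* ε) ℚ.+ (b ℚ.+ ½ ℚ.* ε) ≡ (a ℚ.+ b) ℚ.+ ε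
  +-combine a b ε = begin
    (a ℚ.+ ½ ℚ.* ε) ℚ.+ (b ℚ.+ ½ ℚ.* ε) ≡⟨ interchange a (½ ℚ.* ε) b (½ ℚ.* ε) ⟩
    (a ℚ.+ b) ℚ.+ (½ ℚ.* ε ℚ.+ ½ ℚ.* ε) ≡⟨ cong ((a ℚ.+ b) ℚ.+_) (halves ε) ⟩
    (a ℚ.+ b) ℚ.+ ε                     ∎
    where open ≡-Reasoning

-- Abstract so that proofs do not get unfolded during type checking.
abstract
  const-isCauchy : ∀ q → IsCauchy (λ _ → q)
  const-isCauchy q ε 0<ε = 0 , λ _ _ _ _ →
    subst (λ r → ℚ.∣ r ∣ ℚ.≤ ε) (sym (ℚ.+-inverseʳ q)) (ℚ.<⇒≤ 0<ε)

  +-isCauchy : ∀ {x y} → IsCauchy x → IsCauchy y → IsCauchy (λ i → x i ℚ.+ y i)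
  +-isCauchy {x} {y} cx cy ε 0<ε =
    let (M , f) = cx (½ ℚ.* ε) (half-pos ε 0<ε)
        (N , g) = cy (½ ℚ.* ε) (half-pos ε 0<ε)
        bound : ∀ i j → M ℕ.⊔ N ℕ.≤ i → M ℕ.⊔ N ℕ.≤ j →
                x i ℚ.+ y i ℚ.≤ (x j ℚ.+ y j) ℚ.+ ε
        bound i j p q = subst (x i ℚ.+ y i ℚ.≤_) (+-combine (x j) (y j) ε) $
          ℚ.+-mono-≤
            (∣p-q∣≤ε⇒p≤q+ε (x i) (x j)
              (f i j (ℕ.m⊔n≤o⇒m≤o M N p) (ℕ.m⊔n≤o⇒m≤o M N q)))
            (∣p-q∣≤ε⇒p≤q+ε (y i) (y j)
              (g i j (ℕ.m⊔n≤o⇒n≤o M N p) (ℕ.m⊔n≤o⇒n≤o M N q)))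
    in M ℕ.⊔ N , λ i j p q → p≤q+ε∧q≤p+ε⇒∣p-q∣≤ε
         (x i ℚ.+ y i) (x j ℚ.+ y j) (bound i j p q) (bound j i q p)

  ⊔-isCauchy : ∀ {x y} → IsCauchy x → IsCauchy y → IsCauchy (λ i → x i ℚ.⊔ y i)
  ⊔-isCauchy {x} {y} cx cy ε 0<ε =
    let (M , f) = cx ε 0<ε
        (N , g) = cy ε 0<ε
        bound : ∀ i j → M ℕ.⊔ N ℕ.≤ i → M ℕ.⊔ N ℕ.≤ j →
                x i ℚ.⊔ y i ℚ.≤ (x j ℚ.⊔ y j) ℚ.+ ε
        bound i j p q = ℚ.⊔-lub
          (ℚ.≤-trans
            (∣p-q∣≤ε⇒p≤q+ε (x i) (x j)
              (f i j (ℕ.m⊔n≤o⇒m≤o M N p) (ℕ.m⊔n≤o⇒m≤o M N q)))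
            (ℚ.+-monoˡ-≤ ε (ℚ.p≤p⊔q (x j) (y j))))
          (ℚ.≤-trans
            (∣p-q∣≤ε⇒p≤q+ε (y i) (y j)
              (g i j (ℕ.m⊔n≤o⇒n≤o M N p) (ℕ.m⊔n≤o⇒n≤o M N q)))
            (ℚ.+-monoˡ-≤ ε (ℚ.p≤q⊔p (x j) (y j))))
    in M ℕ.⊔ N , λ i j p q → p≤q+ε∧q≤p+ε⇒∣p-q∣≤ε
         (x i ℚ.⊔ y i) (x j ℚ.⊔ y j) (bound i j p q) (bound j i q p)

fromℚ : ℚ → ℝ
fromℚ q = mkℝ (λ _ → q) (const-isCauchy q)

0ℝ 1ℝ : ℝ
0ℝ = fromℚ 0ℚ
1ℝ = fromℚ 1ℚ

infixl 6 _+_ _⊔_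

_+_ : ℝ → ℝ → ℝ
x + y = mkℝ (λ i → seq x i ℚ.+ seq y i) (+-isCauchy {seq x} {seq y} (cauchy x) (cauchy y))

_⊔_ : ℝ → ℝ → ℝ
x ⊔ y = mkℝ (λ i → seq x i ℚ.⊔ seq y i) (⊔-isCauchy {seq x} {seq y} (cauchy x) (cauchy y))

+-0-rawMonoid : RawMonoid _ _
+-0-rawMonoid = record { Carrier = ℝ ; _≈_ = _≃_ ; _∙_ = _+_ ; ε = 0ℝ }

open RawMonoidDefs +-0-rawMonoid public
  using (sum) renaming (_×_ to _·_)
open RawMonoidDefs ℕ.+-0-rawMonoid public
  using () renaming (sum to sumℕ)

max : ∀ {n} → .{{NonZero n}} → Vector ℝ n → ℝ
max {suc zero}    v = head v
max {suc (suc n)} v = head v ⊔ max (tail v)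

------------------------------------------------------------------------
-- Integer square root

⌊√_⌋ : ℕ → ℕ
⌊√ zero  ⌋ = 0
⌊√ suc n ⌋ with suc ⌊√ n ⌋ ℕ.* suc ⌊√ n ⌋ ℕ.≤? suc n
... | yes _ = suc ⌊√ n ⌋
... | no  _ = ⌊√ n ⌋

⌊√n⌋²≤n : ∀ n → ⌊√ n ⌋ ℕ.* ⌊√ n ⌋ ℕ.≤ n
⌊√n⌋²≤n zero = ℕ.z≤n
⌊√n⌋²≤n (suc n) with suc ⌊√ n ⌋ ℕ.* suc ⌊√ n ⌋ ℕ.≤? suc n
... | yes p = p
... | no _  = ℕ.m≤n⇒m≤1+n (⌊√n⌋²≤n n)

n<[1+⌊√n⌋]² : ∀ n → n ℕ.< suc ⌊√ n ⌋ ℕ.* suc ⌊√ n ⌋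
n<[1+⌊√n⌋]² zero = ℕ.s≤s ℕ.z≤n
n<[1+⌊√n⌋]² (suc n) with suc ⌊√ n ⌋ ℕ.* suc ⌊√ n ⌋ ℕ.≤? suc n
... | yes _ = ℕ.≤-<-trans (n<[1+⌊√n⌋]² n)
                (ℕ.*-mono-< (ℕ.n<1+n (suc ⌊√ n ⌋)) (ℕ.n<1+n (suc ⌊√ n ⌋)))
... | no ¬p = ℕ.≰⇒> ¬p

instance
  ⌊√⌋-nonZero : ∀ {n} → .{{NonZero n}} → NonZero ⌊√ n ⌋
  ⌊√⌋-nonZero {zero}  {{nz}} = ⊥-elim-irr (NonZero.nonZero nz)
  ⌊√⌋-nonZero {suc n} = ℕ.≢-nonZero λ eq →
    ℕ.<⇒≱ (n<[1+⌊√n⌋]² (suc n))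
      (subst (λ r → suc r ℕ.* suc r ℕ.≤ suc n) (sym eq) (ℕ.s≤s ℕ.z≤n))

------------------------------------------------------------------------
-- Data distributions

record DataDistribution (m : ℕ) : Set where
  field
    x          : ℕ
    {{x>0}}    : NonZero x
    D          : Fin m → Fin x → Fin 2
    s          : Vector ℝ x
    s-nonNeg   : ∀ j → 0ℝ ≤ s j
    s-sum      : sum s ≃ 1ℝ

  DᵀD : Fin x → Fin x → ℕ
  DᵀD j k = sumℕ λ i → toℕ (D i j) ℕ.* toℕ (D i k)

  -- n · r is the n-fold sum of r, that is, the product of a natural number
  -- and a real.
  Ds : Vector ℝ m
  Ds i = sum λ j → toℕ (D i j) · s j

open DataDistribution public

IsATAC : ∀ {m} → DataDistribution m → Set
IsATAC P = ∀ j k → DᵀD P j k ≢ 0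

storageLimit : ∀ {m} → .{{NonZero m}} → DataDistribution m → ℝ
storageLimit P = max (Ds P)

-- ℓ is the minimum, not merely the infimum, of the storage limits.
record IsMinimalStorageLimit (m : ℕ) .{{_ : NonZero m}} (ℓ : ℝ) : Set where
  field
    attained   : ∃ λ (P : DataDistribution m) → IsATAC P × storageLimit P ≃ ℓ
    lowerBound : ∀ (P : DataDistribution m) → IsATAC P → ℓ ≤ storageLimit P

{-# OPTIONS --safe #-}
module Submission where

open import Defs
open import Data.Integer.Base using (+_)
open import Data.Nat.Base using (ℕ; suc; NonZero)
open import Data.Rational.Base using (_/_; _⊓_)

open import Algebra.Bundles using (CommutativeMonoid)
import Algebra.Definitions.RawMonoid as RawMonoidDefs
import Algebra.Properties.CommutativeMonoid.Mult as Mult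
import Algebra.Properties.CommutativeMonoid.Sum as Sum
import Algebra.Properties.CommutativeSemigroup as CommutativeSemigroupProperties
open import Data.Fin.Base using (Fin; zero; suc; toℕ)
import Data.Fin.Properties as Fin
import Data.Integer.Base as ℤ
open import Data.Integer.Tactic.RingSolver using (solve-∀)
open import Data.Nat.Base as ℕ using (zero; z≤n; s≤s)
import Data.Nat.Properties as ℕ
open import Data.Product.Base using (_,_; proj₁)
open import Data.Rational.Base as ℚ using (0ℚ; 1ℚ; ½; fromℚᵘ; toℚᵘ)
import Data.Rational.Properties as ℚ
open import Data.Rational.Unnormalised.Base as ℚᵘ using (mkℚᵘ; *≡*)
import Data.Rational.Unnormalised.Properties as ℚᵘ
open import Data.Vec.Functional using (Vector)
open import Level using (0ℓ)
open import Relation.Binary.Bundles using (Poset)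
import Relation.Binary.Reasoning.PartialOrder as PartialOrderReasoning
open import Relation.Binary.PropositionalEquality
  using (_≡_; refl; sym; trans; cong; subst; module ≡-Reasoning)
open import Relation.Nullary using (yes; no)

-- Double counting with weights w on the machines: if every data group has
-- weight at least n, then n ≤ ∑ᵢ wᵢ (D s)ᵢ ≤ (∑ w) · L.  Write k = ⌊√ m ⌋.  If
-- every group is stored on more than k machines, take w = 1, giving k + 1 ≤ m L.
-- Otherwise some group j is stored on at most k machines; take w to be the
-- indicator of these machines.  By the ATAC property every group lies on one of
-- them, so 1 ≤ k L.

open CommutativeSemigroupProperties
  (CommutativeMonoid.commutativeSemigroup ℚ.+-0-commutativeMonoid) using (interchange)
open RawMonoidDefs ℚ.+-0-rawMonoid using (_×_)

-- Natural multiples of rationals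

fromℚᵘ-homo-+ : ∀ p q → fromℚᵘ p ℚ.+ fromℚᵘ q ≡ fromℚᵘ (p ℚᵘ.+ q)
fromℚᵘ-homo-+ p q = ℚ.toℚᵘ-injective (begin
  toℚᵘ (fromℚᵘ p ℚ.+ fromℚᵘ q)            ≈⟨ ℚ.toℚᵘ-homo-+ (fromℚᵘ p) (fromℚᵘ q) ⟩
  toℚᵘ (fromℚᵘ p) ℚᵘ.+ toℚᵘ (fromℚᵘ q)    ≈⟨ ℚᵘ.+-cong (ℚ.toℚᵘ-fromℚᵘ p) (ℚ.toℚᵘ-fromℚᵘ q) ⟩
  p ℚᵘ.+ q                                ≈⟨ ℚ.toℚᵘ-fromℚᵘ (p ℚᵘ.+ q) ⟨
  toℚᵘ (fromℚᵘ (p ℚᵘ.+ q))                ∎)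
  where open ℚᵘ.≃-Reasoning

-- Since `_/_` reduces to lowest terms, the addition in the induction is carried out on unnormalised
-- rationals, where equality is an integer cross-multiplication.
×-/ : ∀ n a d .{{_ : NonZero d}} → n × (a / d) ≡ (+ n ℤ.* a) / d
×-/ zero    a d@(suc _) = ℚ.fromℚᵘ-cong {ℚᵘ.0ℚᵘ} {mkℚᵘ (+ 0) (ℕ.pred d)} (*≡* refl)
×-/ (suc n) a d@(suc e) = begin
  a / d ℚ.+ n × (a / d)         ≡⟨ cong (a / d ℚ.+_) (×-/ n a d) ⟩
  a / d ℚ.+ (+ n ℤ.* a) / d     ≡⟨ fromℚᵘ-homo-+ (mkℚᵘ a e) (mkℚᵘ (+ n ℤ.* a) e) ⟩
  fromℚᵘ (mkℚᵘ a e ℚᵘ.+ mkℚᵘ (+ n ℤ.* a) e)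
    ≡⟨ ℚ.fromℚᵘ-cong {mkℚᵘ a e ℚᵘ.+ mkℚᵘ (+ n ℤ.* a) e} {mkℚᵘ (+ suc n ℤ.* a) e}
         (*≡* (crossMultiply (+ n) a (+ d))) ⟩
  (+ suc n ℤ.* a) / d           ∎
  where
  open ≡-Reasoning
  crossMultiply : ∀ n a d → (a ℤ.* d ℤ.+ n ℤ.* a ℤ.* d) ℤ.* d ≡ (+ 1 ℤ.+ n) ℤ.* a ℤ.* (d ℤ.* d)
  crossMultiply = solve-∀

×-/-cancel : ∀ n d .{{_ : NonZero d}} → d × (+ n / d) ≡ n × 1ℚ
×-/-cancel n d@(suc e) = begin
  d × (+ n / d)          ≡⟨ ×-/ d (+ n) d ⟩
  (+ d ℤ.* + n) / d      ≡⟨ ℚ.fromℚᵘ-cong {mkℚᵘ (+ d ℤ.* + n) e} {mkℚᵘ (+ n ℤ.* + 1) 0}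
                              (*≡* (crossMultiply (+ n) (+ d))) ⟩
  (+ n ℤ.* + 1) / 1      ≡⟨ ×-/ n (+ 1) 1 ⟨
  n × 1ℚ                 ∎
  where
  open ≡-Reasoning
  crossMultiply : ∀ n d → d ℤ.* n ℤ.* + 1 ≡ n ℤ.* + 1 ℤ.* d
  crossMultiply = solve-∀

×-monoʳ-≤ : ∀ n {p q} → p ℚ.≤ q → n × p ℚ.≤ n × q
×-monoʳ-≤ zero    p≤q = ℚ.≤-refl
×-monoʳ-≤ (suc n) p≤q = ℚ.+-mono-≤ p≤q (×-monoʳ-≤ n p≤q)

×-monoʳ-< : ∀ n .{{_ : NonZero n}} {p q} → p ℚ.< q → n × p ℚ.< n × q
×-monoʳ-< (suc n) p<q = ℚ.+-mono-<-≤ p<q (×-monoʳ-≤ n (ℚ.<⇒≤ p<q))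

-- The order on ℚ is decidable, so cancellation follows from strict monotonicity by contradiction.
×-cancelˡ-≤ : ∀ n .{{_ : NonZero n}} {p q} → n × p ℚ.≤ n × q → p ℚ.≤ q
×-cancelˡ-≤ n np≤nq = ℚ.≮⇒≥ λ q<p → ℚ.<-irrefl refl (ℚ.<-≤-trans (×-monoʳ-< n q<p) np≤nq)

-- Order and addition on the reals

pointwise-≤ : ∀ {x y} → (∀ i → seq x i ℚ.≤ seq y i) → x ≤ y
pointwise-≤ {x} {y} x≤y = mk≤ λ ε 0<ε → 0 , λ i _ →
  subst (ℚ._≤ seq y i ℚ.+ ε) (ℚ.+-identityʳ (seq x i)) (ℚ.+-mono-≤ (x≤y i) (ℚ.<⇒≤ 0<ε))

pointwise-≃ : ∀ {x y} → (∀ i → seq x i ≡ seq y i) → x ≃ y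
pointwise-≃ x≡y =
  pointwise-≤ (λ i → ℚ.≤-reflexive (x≡y i)) , pointwise-≤ (λ i → ℚ.≤-reflexive (sym (x≡y i)))

½×-positive : ∀ {ε} → 0ℚ ℚ.< ε → 0ℚ ℚ.< ½ ℚ.* ε
½×-positive {ε} 0<ε = subst (ℚ._< ½ ℚ.* ε) (ℚ.*-zeroʳ ½) (ℚ.*-monoʳ-<-pos ½ 0<ε)

½ε+½ε≡ε : ∀ ε → ½ ℚ.* ε ℚ.+ ½ ℚ.* ε ≡ ε
½ε+½ε≡ε ε = trans (sym (ℚ.*-distribʳ-+ ε ½ ½)) (ℚ.*-identityˡ ε)

≤-refl : ∀ {x} → x ≤ x
≤-refl = pointwise-≤ λ _ → ℚ.≤-refl

≤-trans : ∀ {x y z} → x ≤ y → y ≤ z → x ≤ z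
≤-trans {x} {y} {z} (mk≤ x≤y) (mk≤ y≤z) = mk≤ λ ε 0<ε →
  let M , f = x≤y (½ ℚ.* ε) (½×-positive 0<ε)
      N , g = y≤z (½ ℚ.* ε) (½×-positive 0<ε)
  in M ℕ.⊔ N , λ i M⊔N≤i → begin
    seq x i                                ≤⟨ f i (ℕ.m⊔n≤o⇒m≤o M N M⊔N≤i) ⟩
    seq y i ℚ.+ ½ ℚ.* ε                    ≤⟨ ℚ.+-monoˡ-≤ (½ ℚ.* ε) (g i (ℕ.m⊔n≤o⇒n≤o M N M⊔N≤i)) ⟩
    seq z i ℚ.+ ½ ℚ.* ε ℚ.+ ½ ℚ.* ε        ≡⟨ ℚ.+-assoc (seq z i) (½ ℚ.* ε) (½ ℚ.* ε) ⟩
    seq z i ℚ.+ (½ ℚ.* ε ℚ.+ ½ ℚ.* ε)      ≡⟨ cong (seq z i ℚ.+_) (½ε+½ε≡ε ε) ⟩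
    seq z i ℚ.+ ε                          ∎
  where open ℚ.≤-Reasoning

≤-poset : Poset 0ℓ 0ℓ 0ℓ
≤-poset = record
  { Carrier = ℝ
  ; _≈_     = _≃_
  ; _≤_     = _≤_
  ; isPartialOrder = record
    { isPreorder = record
      { isEquivalence = record
        { refl  = ≤-refl , ≤-refl
        ; sym   = λ (x≤y , y≤x) → y≤x , x≤y
        ; trans = λ (x≤y , y≤x) (y≤z , z≤y) → ≤-trans x≤y y≤z , ≤-trans z≤y y≤x
        }
      ; reflexive = proj₁
      ; trans     = ≤-trans
      }
    ; antisym = _,_
    }
  }

+-mono-≤ : ∀ {x y u v} → x ≤ y → u ≤ v → x + u ≤ y + v
+-mono-≤ {x} {y} {u} {v} (mk≤ x≤y) (mk≤ u≤v) = mk≤ λ ε 0<ε →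
  let M , f = x≤y (½ ℚ.* ε) (½×-positive 0<ε)
      N , g = u≤v (½ ℚ.* ε) (½×-positive 0<ε)
  in M ℕ.⊔ N , λ i M⊔N≤i → begin
    seq x i ℚ.+ seq u i
      ≤⟨ ℚ.+-mono-≤ (f i (ℕ.m⊔n≤o⇒m≤o M N M⊔N≤i)) (g i (ℕ.m⊔n≤o⇒n≤o M N M⊔N≤i)) ⟩
    (seq y i ℚ.+ ½ ℚ.* ε) ℚ.+ (seq v i ℚ.+ ½ ℚ.* ε)
      ≡⟨ interchange (seq y i) (½ ℚ.* ε) (seq v i) (½ ℚ.* ε) ⟩
    (seq y i ℚ.+ seq v i) ℚ.+ (½ ℚ.* ε ℚ.+ ½ ℚ.* ε)
      ≡⟨ cong (seq y i ℚ.+ seq v i ℚ.+_) (½ε+½ε≡ε ε) ⟩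
    seq y i ℚ.+ seq v i ℚ.+ ε  ∎
  where open ℚ.≤-Reasoning

-- Gives access to the general laws of multiples and finite sums, notably the interchange `∑-comm`
-- behind the double counting.
+-0-commutativeMonoid : CommutativeMonoid 0ℓ 0ℓ
+-0-commutativeMonoid = record
  { Carrier = ℝ
  ; _≈_     = _≃_
  ; _∙_     = _+_
  ; ε       = 0ℝ
  ; isCommutativeMonoid = record
    { isMonoid = record
      { isSemigroup = record
        { isMagma = record
          { isEquivalence = Poset.isEquivalence ≤-poset
          ; ∙-cong = λ (x≤y , y≤x) (u≤v , v≤u) → +-mono-≤ x≤y u≤v , +-mono-≤ y≤x v≤u
          }
        ; assoc = λ x y z → pointwise-≃ λ i → ℚ.+-assoc (seq x i) (seq y i) (seq z i)
        }
      ; identity = (λ x → pointwise-≃ λ i → ℚ.+-identityˡ (seq x i))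
                 , (λ x → pointwise-≃ λ i → ℚ.+-identityʳ (seq x i))
      }
    ; comm = λ x y → pointwise-≃ λ i → ℚ.+-comm (seq x i) (seq y i)
    }
  }

open CommutativeMonoid +-0-commutativeMonoid using () renaming (∙-congˡ to +-congˡ)
open Poset ≤-poset using (module Eq)
open Mult +-0-commutativeMonoid using (×-homo-+; ×-assocˡ; ×-congʳ; ×-distrib-+)
open Sum +-0-commutativeMonoid using (sum-cong-≋; sum-replicate; sum-replicate-zero; ∑-comm)

-- Natural multiples of reals

seq-· : ∀ n x i → seq (n · x) i ≡ n × seq x i
seq-· zero    x i = refl
seq-· (suc n) x i = cong (seq x i ℚ.+_) (seq-· n x i)

-- The argument runs on the approximating rationals: slack `ε` in the conclusion is bought with
-- slack `n × ε` in the hypothesis, and then `n` cancels in ℚ.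
·-cancelˡ-≤ : ∀ n .{{_ : NonZero n}} {x y} → n · x ≤ n · y → x ≤ y
·-cancelˡ-≤ n@(suc _) {x} {y} (mk≤ nx≤ny) = mk≤ λ ε 0<ε →
  -- Idempotence of `0ℚ` turns `n × 0ℚ < n × ε` into positivity of the slack.
  let N , f = nx≤ny (n × ε) (subst (ℚ._< n × ε) (×ℚ.×-idem refl n) (×-monoʳ-< n 0<ε))
  in N , λ i N≤i → ×-cancelˡ-≤ n (begin
    n × seq x i                     ≡⟨ seq-· n x i ⟨
    seq (n · x) i                   ≤⟨ f i N≤i ⟩
    seq (n · y) i ℚ.+ n × ε         ≡⟨ cong (ℚ._+ n × ε) (seq-· n y i) ⟩
    n × seq y i ℚ.+ n × ε           ≡⟨ ×ℚ.×-distrib-+ (seq y i) ε n ⟨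
    n × (seq y i ℚ.+ ε)             ∎)
  where
  open ℚ.≤-Reasoning
  module ×ℚ = Mult ℚ.+-0-commutativeMonoid

·-fromℚ-/ : ∀ n d .{{_ : NonZero d}} → d · fromℚ (+ n / d) ≃ n · 1ℝ
·-fromℚ-/ n d = pointwise-≃ λ i → begin
  seq (d · fromℚ (+ n / d)) i  ≡⟨ seq-· d (fromℚ (+ n / d)) i ⟩
  d × (+ n / d)                ≡⟨ ×-/-cancel n d ⟩
  n × 1ℚ                       ≡⟨ seq-· n 1ℝ i ⟨
  seq (n · 1ℝ) i               ∎
  where open ≡-Reasoning

fromℚ-mono-≤ : ∀ {p q} → p ℚ.≤ q → fromℚ p ≤ fromℚ q
fromℚ-mono-≤ p≤q = pointwise-≤ λ _ → p≤q

module ≤-Reasoning = PartialOrderReasoning ≤-poset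

·-monoʳ-≤ : ∀ n {x y} → x ≤ y → n · x ≤ n · y
·-monoʳ-≤ zero    x≤y = ≤-refl
·-monoʳ-≤ (suc n) x≤y = +-mono-≤ x≤y (·-monoʳ-≤ n x≤y)

+-nonNeg : ∀ {x y} → 0ℝ ≤ x → 0ℝ ≤ y → 0ℝ ≤ x + y
+-nonNeg {x} {y} 0≤x 0≤y =
  -- The approximants of `0ℝ` and `0ℝ + 0ℝ` agree by computation.
  ≤-trans (pointwise-≤ λ _ → ℚ.≤-refl) (+-mono-≤ {0ℝ} {x} {0ℝ} {y} 0≤x 0≤y)

·-nonNeg : ∀ n {x} → 0ℝ ≤ x → 0ℝ ≤ n · x
·-nonNeg zero    0≤x = ≤-refl
·-nonNeg (suc n) 0≤x = +-nonNeg 0≤x (·-nonNeg n 0≤x)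

·-monoˡ-≤ : ∀ {m n x} → 0ℝ ≤ x → m ℕ.≤ n → m · x ≤ n · x
·-monoˡ-≤ 0≤x (z≤n {n}) = ·-nonNeg n 0≤x
·-monoˡ-≤ 0≤x (s≤s m≤n) = +-mono-≤ ≤-refl (·-monoˡ-≤ 0≤x m≤n)

-- Finite sums and the maximum

sum-mono-≤ : ∀ {n} {u v : Vector ℝ n} → (∀ i → u i ≤ v i) → sum u ≤ sum v
sum-mono-≤ {zero}  u≤v = ≤-refl
sum-mono-≤ {suc n} u≤v = +-mono-≤ (u≤v zero) (sum-mono-≤ λ i → u≤v (suc i))

sum-nonNeg : ∀ {n} {v : Vector ℝ n} → (∀ i → 0ℝ ≤ v i) → 0ℝ ≤ sum v
sum-nonNeg {zero}  0≤v = ≤-refl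
sum-nonNeg {suc n} 0≤v = +-nonNeg (0≤v zero) (sum-nonNeg λ i → 0≤v (suc i))

·-distrib-sum : ∀ k {n} (v : Vector ℝ n) → k · sum v ≃ sum λ i → k · v i
-- The empty sum leaves `k · 0ℝ ≃ 0ℝ`, obtained by reading `k · 0ℝ` as a sum of `k` zeros.
·-distrib-sum k {zero}  v = Eq.trans (Eq.sym (sum-replicate k)) (sum-replicate-zero k)
·-distrib-sum k {suc n} v = Eq.trans (×-distrib-+ (v zero) _ k)
  (+-congˡ {k · v zero} (·-distrib-sum k λ i → v (suc i)))

sumℕ-· : ∀ {n} (w : Vector ℕ n) x → (sum λ i → w i · x) ≃ sumℕ w · x
sumℕ-· {zero}  w x = Eq.refl
sumℕ-· {suc n} w x = Eq.trans (+-congˡ {w zero · x} (sumℕ-· (λ i → w (suc i)) x))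
  (Eq.sym (×-homo-+ x (w zero) _))

sumℕ-replicate-1 : ∀ n → (sumℕ {n} λ _ → 1) ≡ n
sumℕ-replicate-1 zero    = refl
sumℕ-replicate-1 (suc n) = cong suc (sumℕ-replicate-1 n)

lookup≤max : ∀ {n} .{{_ : NonZero n}} (v : Vector ℝ n) i → v i ≤ max v
lookup≤max {suc zero}    v zero    = ≤-refl
lookup≤max {suc (suc n)} v zero    = pointwise-≤ λ k → ℚ.p≤p⊔q (seq (v zero) k) _
lookup≤max {suc (suc n)} v (suc i) = ≤-trans (lookup≤max (λ j → v (suc j)) i)
  (pointwise-≤ λ k → ℚ.p≤q⊔p (seq (v zero) k) _)

-- Weighted double counting

storageLimit-nonNeg : ∀ {m} .{{_ : NonZero m}} (P : DataDistribution m) → 0ℝ ≤ storageLimit P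
storageLimit-nonNeg {suc m} P = ≤-trans
  (sum-nonNeg λ j → ·-nonNeg (toℕ (D P zero j)) (s-nonNeg P j))
  (lookup≤max (Ds P) zero)

-- Interchanging the two sums collects, for each group `j`, the total weight of the machines that
-- hold it.
sum-w·Ds : ∀ {m} (P : DataDistribution m) (w : Vector ℕ m) →
  (sum λ i → w i · Ds P i) ≃ sum λ j → (sumℕ λ i → w i ℕ.* toℕ (D P i j)) · s P j
sum-w·Ds P w = begin-equality
  (sum λ i → w i · sum λ j → d i j · s P j)
    ≈⟨ sum-cong-≋ (λ i → Eq.trans (·-distrib-sum (w i) λ j → d i j · s P j)
         (sum-cong-≋ λ j → ×-assocˡ (s P j) (w i) (d i j))) ⟩
  (sum λ i → sum λ j → (w i ℕ.* d i j) · s P j)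
    ≈⟨ ∑-comm (λ i j → (w i ℕ.* d i j) · s P j) ⟩
  (sum λ j → sum λ i → (w i ℕ.* d i j) · s P j)
    ≈⟨ sum-cong-≋ (λ j → sumℕ-· (λ i → w i ℕ.* d i j) (s P j)) ⟩
  (sum λ j → (sumℕ λ i → w i ℕ.* d i j) · s P j) ∎
  where
  open ≤-Reasoning
  d = λ i j → toℕ (D P i j)

-- Both sides are compared after multiplication by `k`, so that no division of reals occurs. The
-- total weight is only bounded by `k`, because a group may have fewer than `k` copies.
weighted-bound : ∀ {m} .{{_ : NonZero m}} (P : DataDistribution m) (w : Vector ℕ m) n k
  .{{_ : NonZero k}} →
  (∀ j → n ℕ.≤ sumℕ λ i → w i ℕ.* toℕ (D P i j)) → sumℕ w ℕ.≤ k →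
  fromℚ (+ n / k) ≤ storageLimit P
weighted-bound P w n k n≤weight w≤k = ·-cancelˡ-≤ k (begin
  k · fromℚ (+ n / k)               ≈⟨ ·-fromℚ-/ n k ⟩
  n · 1ℝ                            ≈⟨ ×-congʳ n (s-sum P) ⟨
  n · sum (s P)                     ≈⟨ ·-distrib-sum n (s P) ⟩
  (sum λ j → n · s P j)             ≤⟨ sum-mono-≤ (λ j → ·-monoˡ-≤ (s-nonNeg P j) (n≤weight j)) ⟩
  (sum λ j → (sumℕ λ i → w i ℕ.* toℕ (D P i j)) · s P j)
                                    ≈⟨ sum-w·Ds P w ⟨
  (sum λ i → w i · Ds P i)          ≤⟨ sum-mono-≤ (λ i → ·-monoʳ-≤ (w i) (lookup≤max (Ds P) i)) ⟩
  (sum λ i → w i · storageLimit P)  ≈⟨ sumℕ-· w (storageLimit P) ⟩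
  -- Raising the total weight to `k` requires a nonnegative limit.
  sumℕ w · storageLimit P           ≤⟨ ·-monoˡ-≤ (storageLimit-nonNeg P) w≤k ⟩
  k · storageLimit P                ∎)
  where open ≤-Reasoning

-- Case split on the number of copies

replication : ∀ {m} (P : DataDistribution m) → Fin (x P) → ℕ
replication P j = sumℕ λ i → toℕ (D P i j)

-- The threshold `k` is left arbitrary: the first fraction grows with `k` and the second shrinks,
-- and `⌊√ m ⌋` is the choice that balances them.
storageLimit-bound : ∀ {m} .{{_ : NonZero m}} (P : DataDistribution m) → IsATAC P →
  ∀ k .{{_ : NonZero k}} → fromℚ ((+ suc k / m) ⊓ (+ 1 / k)) ≤ storageLimit P
storageLimit-bound {m} P atac k with Fin.any? (λ j → replication P j ℕ.≤? k)
... | yes (j₀ , c≤k) = ≤-trans (fromℚ-mono-≤ (ℚ.p⊓q≤q (+ suc k / m) (+ 1 / k)))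
  -- With column `j₀` as weights, the weight of group `j` is the entry `DᵀD P j₀ j`; being nonzero,
  -- it is at least 1.
  (weighted-bound P (λ i → toℕ (D P i j₀)) 1 k (λ j → ℕ.n≢0⇒n>0 (atac j₀ j)) c≤k)
... | no c≰k = ≤-trans (fromℚ-mono-≤ (ℚ.p⊓q≤p (+ suc k / m) (+ 1 / k)))
  (weighted-bound P (λ _ → 1) (suc k) m
    -- Having more than `k` copies is by definition `suc k ≤ replication P j`; this is where the
    -- numerator `suc k` comes from.
    (λ j → subst (k ℕ.<_) (sumℕ-cong λ i → sym (ℕ.*-identityˡ (toℕ (D P i j))))
      (ℕ.≰⇒> λ c≤k → c≰k (j , c≤k)))
    (ℕ.≤-reflexive (sumℕ-replicate-1 m)))
  where
  open Sum ℕ.+-0-commutativeMonoid using () renaming (sum-cong-≗ to sumℕ-cong)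

theorem4 : (m : ℕ) .{{_ : NonZero m}} (Lmin : ℝ) →
    IsMinimalStorageLimit m Lmin →
    fromℚ ((+ suc ⌊√ m ⌋ / m) ⊓ (+ 1 / ⌊√ m ⌋)) ≤ Lmin
theorem4 m Lmin isMin =
  -- The bound is applied to a distribution that attains the minimum.
  let P , atac , L≤Lmin , _ = IsMinimalStorageLimit.attained isMin
  in ≤-trans (storageLimit-bound P atac ⌊√ m ⌋) L≤Lmin
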